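{- Let $\dot A$ be a colored antichain on at least $2$ vertices which is not monochromatic, and let $n$ be sufficiently large. If $\dot A$ has no three vertices of the same color, then $\tilde{R}(\dot A,Q_n)=n+2$. Otherwise, $\tilde{R}(\dot A,Q_n)=n+3$.
   Context: An antichain is a poset whose elements are pairwise incomparable. $Q_N$ denotes the Boolean lattice of all subsets of an $N$-element set ordered by inclusion. An (induced) copy of a poset $P$ in a poset $Q$ is a subset of $Q$ which, with the inherited order, is isomorphic to $P$. A colored poset $\dot P$ is a poset with a coloring of its elements in blue and red; a copy of $\dot P$ in a colored $Q$ is an induced copy of $P$ whose vertices have the same colors as the corresponding vertices of $\dot P$. A colored poset is monochromatic if all its vertices have the same color. $\dot Q_n^{(b)}$ (resp. $\dot Q_n^{(r)}$) is $Q_n$ colored entirely blue (resp. red). $\tilde{R}(\dot P,Q_n)$ is the minimum $N$ such that every blue/red coloring of $Q_N$ contains a copy of $\dot P$, of $\dot Q_n^{(b)}$, or of $\dot Q_n^{(r)}$. -}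

module Defs where

open import Data.Nat using (ℕ; _≤_; _<_; _+_)
open import Data.Fin using (Fin)
open import Data.Fin.Subset using (Subset; _⊆_)
open import Data.Product using (Σ; ∃; _×_; _,_)
open import Data.Sum using (_⊎_)
open import Relation.Binary.PropositionalEquality using (_≡_; _≢_)
open import Relation.Nullary using (¬_)
open import Function.Bundles using (_⇔_)
open import Function.Definitions using (Injective)

data Color : Set where
  blue red : Color

-- The Boolean lattice Q_N is (Subset N, _⊆_).

IsInducedCopy : {A : Set} → (A → A → Set) → (N : ℕ) → (A → Subset N) → Set
IsInducedCopy {A} _≼_ N f =
  Injective _≡_ _≡_ f × (∀ x y → (x ≼ y) ⇔ (f x ⊆ f y))

HasColoredCopy : {A : Set} → (A → A → Set) → (A → Color) →
                 (N : ℕ) → (Subset N → Color) → Set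
HasColoredCopy {A} _≼_ c N χ =
  Σ (A → Subset N) λ f → IsInducedCopy _≼_ N f × (∀ x → χ (f x) ≡ c x)

HasAntichainCopy : (k : ℕ) → (Fin k → Color) → (N : ℕ) → (Subset N → Color) → Set
HasAntichainCopy k c N χ = HasColoredCopy {Fin k} _≡_ c N χ

HasMonoCubeCopy : (n : ℕ) → Color → (N : ℕ) → (Subset N → Color) → Set
HasMonoCubeCopy n col N χ = HasColoredCopy {Subset n} _⊆_ (λ _ → col) N χ

Arrows : (k : ℕ) → (Fin k → Color) → (n N : ℕ) → Set
Arrows k c n N = (χ : Subset N → Color) →
  HasAntichainCopy k c N χ ⊎ HasMonoCubeCopy n blue N χ ⊎ HasMonoCubeCopy n red N χ

RamseyIs : (k : ℕ) → (Fin k → Color) → (n m : ℕ) → Set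
RamseyIs k c n m = Arrows k c n m × (∀ N → N < m → ¬ Arrows k c n N)

NotMonochromatic : {k : ℕ} → (Fin k → Color) → Set
NotMonochromatic {k} c = ∃ λ i → ∃ λ j → c i ≢ c j

HasThreeSameColor : {k : ℕ} → (Fin k → Color) → Set
HasThreeSameColor {k} c = ∃ λ i → ∃ λ j → ∃ λ l →
  (i ≢ j) × (i ≢ l) × (j ≢ l) × (c i ≡ c j) × (c i ≡ c l)

-- Lower bounds: colour ∅ and the full set red and all other sets blue or, when three vertices
-- share a colour, give that colour exactly to the initial and final segments of Fin N. An
-- embedding f of Q_n in Q_N has markers p i ∈ f {i} \ f ([n] \ {i}), so that p i ∈ f S iff
-- i ∈ S; if f ∅ ≠ ∅ and f [n] ≠ [N], two further points x, y exist, and for N = n + 2 the image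
-- is the whole interval from {x} to [N] \ {y}, which contains a segment.
--
-- Upper bounds: if the opposite colour has no Q_n, then for N = n + 2 every interval from {x} to
-- [N] \ {y}, and for N = n + 3 every interval from {x} to [N] \ {y, z}, contains a set of colour c.
-- This yields an antichain of s sets of colour c with many common incomparable sets (with s = 2
-- for N = n + 2). For N = n + 3, either the minimal sets of colour c containing some x include
-- s sets, or for each x fewer than s of them, m_1 x, m_2 x, …, suffice to avoid every pair y, z;
-- by Ramsey's theorem for pairs there are then an i and many points h such that m_i h contains
-- no other of these points. Having such antichains in both colours, one adjusts them, through the
-- sets incomparable to them, to an antichain of s blue and s red sets.
module Submission where

open import Defs
open import Data.Nat using (ℕ; zero; suc; _≤_; _<_; _+_; _*_; z≤n; s≤s)
open import Data.Nat.Properties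
  using (≤-refl; ≤-trans; ≤-reflexive; <⇒≱; ≰⇒>; _≤?_; +-suc; +-comm; +-identityʳ; +-mono-<; m<1+n⇒m<n∨m≡n;
         m≤n⇒m≤1+n; m≤m+n; m≤n+m)
open import Data.Nat.Induction using (<-wellFounded)
open import Induction.WellFounded using (Acc; acc)
open import Data.Fin as Fin using (Fin; zero; suc; combine; inject≤)
open import Data.Fin.Properties as Fin using (any?; all?; ¬∀⟶∃¬; injective⇒≤)
open import Data.Fin.Subset using (Subset; _∈_; _∉_; _⊆_; ⊥; ⊤; ⁅_⁆; ∁; ∣_∣)
open import Data.Fin.Subset.Properties
  using (_∈?_; _⊆?_; anySubset?; ⊆-antisym; ⊆-trans; ⊆-refl; ∉⊥; ∈⊤; x∈⁅x⁆; x∈⁅y⁆⇒x≡y;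
         x∈p⇒x∉∁p; x∉p⇒x∈∁p; ⊥⊆; ⊆⊤; p⊂q⇒∣p∣<∣q∣)
open import Data.List using (List; []; _∷_; _++_; length; lookup; allFin)
import Data.List as List
open import Data.List.Properties using (length-++; length-tabulate)
open import Data.List.Membership.Propositional as List using ()
open import Data.List.Membership.Propositional.Properties as List
  using (∈-lookup; ∈-tabulate⁺; ∈-++⁺ˡ; ∈-++⁺ʳ)
open import Data.List.Relation.Unary.All as All using (All; []; _∷_)
open import Data.List.Relation.Unary.Any as Any using (Any; here; there)
open import Data.List.Relation.Unary.AllPairs as AllPairs using (AllPairs; []; _∷_)
open import Data.List.Relation.Unary.Unique.Propositional using (Unique)
open import Data.List.Relation.Unary.Unique.Propositional.Properties using (allFin⁺)
open import Data.List.Relation.Binary.Sublist.Propositional as Sublist using ([]; _∷_; _∷ʳ_) renaming (_⊆_ to _⊑_)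
open import Data.List.Relation.Binary.Sublist.Propositional.Properties using (All-resp-⊆)
open import Data.Product using (∃; ∃₂; _×_; _,_; proj₁; proj₂)
open import Data.Sum as Sum using (_⊎_; inj₁; inj₂; [_,_]′)
open import Data.Bool using (true; if_then_else_)
open import Data.Vec using (tabulate)
open import Data.Vec.Properties using ([]=⇒lookup; lookup⇒[]=; lookup∘tabulate)
open import Data.Vec.Functional as Vector using ()
open import Function using (_∘_; id)
open import Function.Bundles using (Equivalence; mk⇔)
open import Function.Definitions using (Injective)
open import Level using (0ℓ)
open import Relation.Binary using (Rel; DecidableEquality; Symmetric; tri<; tri≈; tri>) renaming (Decidable to Decidable₂)
open import Relation.Binary.PropositionalEquality
  using (_≡_; _≢_; refl; sym; trans; cong; cong₂; subst; module ≡-Reasoning)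
open import Relation.Nullary using (¬_; Dec; yes; no; does; contradiction)
open import Relation.Nullary.Decidable using (dec-true; decidable-stable; ¬?; _×-dec_; _⊎-dec_; _→-dec_)
open import Relation.Unary using (Pred; Decidable)

-- Colours, subsets and fresh points

opposite : Color → Color
opposite blue = red
opposite red  = blue

_≟ᶜ_ : DecidableEquality Color
blue ≟ᶜ blue = yes refl
blue ≟ᶜ red  = no λ ()
red  ≟ᶜ blue = no λ ()
red  ≟ᶜ red  = yes refl

opposite-involutive : ∀ c → opposite (opposite c) ≡ c
opposite-involutive blue = refl
opposite-involutive red  = refl

≢⇒≡opposite : ∀ {c d} → c ≢ d → c ≡ opposite d
≢⇒≡opposite {blue} {blue} c≢d = contradiction refl c≢d
≢⇒≡opposite {blue} {red}  _   = refl
≢⇒≡opposite {red}  {blue} _   = refl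
≢⇒≡opposite {red}  {red}  c≢d = contradiction refl c≢d

opposite≢ : ∀ c → opposite c ≢ c
opposite≢ blue ()
opposite≢ red  ()

∉-∈⇒≢ : ∀ {N} {S : Subset N} {x y} → x ∉ S → y ∈ S → x ≢ y
∉-∈⇒≢ x∉S y∈S refl = x∉S y∈S

⊈⇒∃ : ∀ {N} {S T : Subset N} → ¬ (S ⊆ T) → ∃ λ x → x ∈ S × x ∉ T
⊈⇒∃ {S = S} {T} S⊈T with any? (λ x → x ∈? S ×-dec ¬? (x ∈? T))
... | yes w = w
... | no ¬w = contradiction
  (λ {x} x∈S → decidable-stable (x ∈? T) (λ x∉T → ¬w (x , x∈S , x∉T))) S⊈T

does⇒ : ∀ {A : Set} (a? : Dec A) → does a? ≡ true → A
does⇒ (yes a) _ = a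

module _ {N} {P : Pred (Fin N) 0ℓ} (P? : Decidable P) where

  comprehension : Subset N
  comprehension = tabulate (does ∘ P?)

  ∈-comprehension⁺ : ∀ {x} → P x → x ∈ comprehension
  ∈-comprehension⁺ {x} px =
    lookup⇒[]= x _ (trans (lookup∘tabulate (does ∘ P?) x) (dec-true (P? x) px))

  ∈-comprehension⁻ : ∀ {x} → x ∈ comprehension → P x
  ∈-comprehension⁻ {x} x∈ =
    does⇒ (P? x) (trans (sym (lookup∘tabulate (does ∘ P?) x)) ([]=⇒lookup x∈))

freshPoint : ∀ {N} (xs : List (Fin N)) → length xs < N → ∃ λ z → z List.∉ xs
freshPoint {N} xs l<N = ¬∀⟶∃¬ N (List._∈ xs) (λ z → Any.any? (z Fin.≟_) xs) ¬all
  where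
  ¬all : ¬ (∀ z → z List.∈ xs)
  ¬all all = <⇒≱ l<N (injective⇒≤ λ {x} {y} eq →
    trans (lookup-index (all x)) (trans (cong (lookup xs) eq) (sym (lookup-index (all y)))))
    where
    open import Data.List.Relation.Unary.Any.Properties using (lookup-index)

cons-injective : ∀ {A : Set} {q} {x : A} {f : Fin q → A} → (∀ i → x ≢ f i) →
                 Injective _≡_ _≡_ f → Injective _≡_ _≡_ (x Vector.∷ f)
cons-injective x≢f inj {zero}  {zero}  eq = refl
cons-injective x≢f inj {zero}  {suc j} eq = contradiction eq (x≢f j)
cons-injective x≢f inj {suc i} {zero}  eq = contradiction (sym eq) (x≢f i)
cons-injective x≢f inj {suc i} {suc j} eq = cong suc (inj eq)

freshPoints : ∀ {N} q (xs : List (Fin N)) → q + length xs ≤ N →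
              ∃ λ (f : Fin q → Fin N) → Injective _≡_ _≡_ f × (∀ i → f i List.∉ xs)
freshPoints zero    xs _ = (λ ()) , (λ { {()} }) , λ ()
freshPoints (suc q) xs q≤N
  with z , z∉ ← freshPoint xs (≤-trans (s≤s (m≤n+m _ q)) q≤N)
  with f , inj , f∉ ← freshPoints q (z ∷ xs) (≤-trans (≤-reflexive (+-suc q _)) q≤N) =
  z Vector.∷ f , cons-injective (λ i z≡ → f∉ i (here (sym z≡))) inj ,
  λ { zero → z∉ ; (suc i) → f∉ i ∘ there }

-- Monochromatic cubes in intervals

-- Choose `n` points `p i` outside `x ∷ ys`. The sets consisting of `x` and the `p i` with `i ∈ S`
-- form a copy of `Q_n`, and each of them contains `x` and misses `ys`, so it has colour `c` unless
-- it is a hit.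
cubeOrHit : ∀ {n N} (χ : Subset N → Color) c x (ys : List (Fin N)) → All (x ≢_) ys →
            n + suc (length ys) ≤ N →
            HasMonoCubeCopy n c N χ ⊎ ∃ λ R → χ R ≡ opposite c × x ∈ R × All (_∉ R) ys
cubeOrHit {n} {N} χ c x ys x≢ys n≤N
  with anySubset? (λ R → (χ R ≟ᶜ opposite c) ×-dec (x ∈? R) ×-dec All.all? (λ y → ¬? (y ∈? R)) ys)
... | yes hit = inj₂ hit
... | no ¬hit with p , p-inj , p∉ ← freshPoints n (x ∷ ys) n≤N = inj₁ (f , (inj , λ S T → mk⇔ mono reflect) , col)
  where
  P? : ∀ S → Decidable (λ z → z ≡ x ⊎ ∃ λ i → i ∈ S × p i ≡ z)
  P? S z = (z Fin.≟ x) ⊎-dec any? (λ i → (i ∈? S) ×-dec (p i Fin.≟ z))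

  f : Subset n → Subset N
  f S = comprehension (P? S)

  mono : ∀ {S T} → S ⊆ T → f S ⊆ f T
  mono {S} {T} S⊆T z∈ with ∈-comprehension⁻ (P? S) z∈
  ... | inj₁ z≡x = ∈-comprehension⁺ (P? T) (inj₁ z≡x)
  ... | inj₂ (i , i∈S , eq) = ∈-comprehension⁺ (P? T) (inj₂ (i , S⊆T i∈S , eq))

  reflect : ∀ {S T} → f S ⊆ f T → S ⊆ T
  reflect {S} {T} fS⊆fT {i} i∈S
    with ∈-comprehension⁻ (P? T) (fS⊆fT (∈-comprehension⁺ (P? S) (inj₂ (i , i∈S , refl))))
  ... | inj₁ pi≡x = contradiction (here pi≡x) (p∉ i)
  ... | inj₂ (j , j∈T , eq) = subst (_∈ T) (p-inj eq) j∈T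

  inj : Injective _≡_ _≡_ f
  inj {S} {T} eq = ⊆-antisym (reflect (subst (f S ⊆_) eq ⊆-refl)) (reflect (subst (_⊆ f S) eq ⊆-refl))

  avoid : ∀ S {y} → y List.∈ ys → y ∉ f S
  avoid S {y} y∈ys y∈ with ∈-comprehension⁻ (P? S) y∈
  ... | inj₁ y≡x = All.lookup x≢ys y∈ys (sym y≡x)
  ... | inj₂ (i , _ , refl) = p∉ i (there y∈ys)

  col : ∀ S → χ (f S) ≡ c
  col S = decidable-stable (χ (f S) ≟ᶜ c) λ ≢c →
    ¬hit (f S , ≢⇒≡opposite ≢c , ∈-comprehension⁺ (P? S) (inj₁ refl) , All.tabulate (avoid S))

singleton : ∀ {N} {S : Subset N} {x} → x ∈ S → ¬ (∃ λ a → a ∈ S × a ≢ x) → S ≡ ⁅ x ⁆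
singleton {S = S} {x} x∈S unique = ⊆-antisym
  (λ {a} a∈S → subst (_∈ ⁅ x ⁆) (sym (decidable-stable (a Fin.≟ x) λ a≢x → unique (a , a∈S , a≢x))) (x∈⁅x⁆ x))
  (λ {a} a∈ → subst (_∈ S) (sym (x∈⁅y⁆⇒x≡y x a∈)) x∈S)

-- Pulls one cube out of finitely many dichotomies, so that otherwise all hits are available at
-- once.
collect : ∀ {A : Set} {N} {B : Fin N → Set} → (∀ i → A ⊎ B i) → A ⊎ (∀ i → B i)
collect {N = zero}  f = inj₂ λ ()
collect {N = suc N} f with f zero | collect (f ∘ suc)
... | inj₁ a | _      = inj₁ a
... | inj₂ b | inj₁ a = inj₁ a
... | inj₂ b | inj₂ g = inj₂ λ { zero → b ; (suc i) → g i }

-- Split and bicoloured antichains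

-- Any set containing all outer points and no inner point is incomparable to every member.
record SplitAntichain {N} (χ : Subset N → Color) (c : Color) (s : ℕ) : Set where
  field
    member      : Fin s → Subset N
    coloured    : ∀ i → χ (member i) ≡ c
    antichain   : ∀ {i j} → member i ⊆ member j → i ≡ j
    inner outer : Fin s → Fin N
    inner∈      : ∀ i → inner i ∈ member i
    outer∉      : ∀ i → outer i ∉ member i
    outer≢inner : ∀ i j → outer i ≢ inner j

-- A universal target: it contains every coloured antichain with at most `s` vertices of each
-- colour.
record BicoloredAntichain {N} (χ : Subset N → Color) (s : ℕ) : Set where
  field
    member    : Color → Fin s → Subset N
    coloured  : ∀ c i → χ (member c i) ≡ c
    antichain : ∀ {c d i j} → member c i ⊆ member d j → c ≡ d × i ≡ j

bicoloredAntichain :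
  ∀ {N} {χ : Subset N → Color} {s} c (A B : Fin s → Subset N) →
  (∀ i → χ (A i) ≡ c) → (∀ i → χ (B i) ≡ opposite c) →
  (∀ {i j} → A i ⊆ A j → i ≡ j) → (∀ {i j} → B i ⊆ B j → i ≡ j) →
  (∀ i j → ¬ (A i ⊆ B j)) → (∀ i j → ¬ (B i ⊆ A j)) →
  BicoloredAntichain χ s
bicoloredAntichain {χ = χ} {s} blue A B colA colB antiA antiB A⊈B B⊈A = record
  { member    = λ { blue → A ; red → B }
  ; coloured  = λ { blue → colA ; red → colB }
  ; antichain = λ { {blue} {blue} p → refl , antiA p ; {red} {red} p → refl , antiB p
                  ; {blue} {red} p → contradiction (λ {x} → p {x}) (A⊈B _ _)
                  ; {red} {blue} p → contradiction (λ {x} → p {x}) (B⊈A _ _) } }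
bicoloredAntichain {χ = χ} {s} red A B colA colB antiA antiB A⊈B B⊈A = record
  { member    = λ { red → A ; blue → B }
  ; coloured  = λ { red → colA ; blue → colB }
  ; antichain = λ { {red} {red} p → refl , antiA p ; {blue} {blue} p → refl , antiB p
                  ; {red} {blue} p → contradiction (λ {x} → p {x}) (A⊈B _ _)
                  ; {blue} {red} p → contradiction (λ {x} → p {x}) (B⊈A _ _) } }

-- Members of different colours are already distinct, so `h` has to be injective only within each
-- colour class.
antichainCopy : ∀ {N} {χ : Subset N → Color} {s k} {c : Fin k → Color} →
                BicoloredAntichain χ s → (h : Fin k → Fin s) →
                (∀ {i j} → c i ≡ c j → h i ≡ h j → i ≡ j) → HasAntichainCopy k c N χ
antichainCopy {c = c} A h h-inj =
  (λ i → member (c i) (h i)) ,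
  ((λ {i} {j} eq → ⊆⇒≡ (subst (member (c i) (h i) ⊆_) eq ⊆-refl)) ,
   λ i j → mk⇔ (λ { refl → ⊆-refl }) ⊆⇒≡) ,
  λ i → coloured (c i) (h i)
  where
  open BicoloredAntichain A
  ⊆⇒≡ : ∀ {i j} → member (c i) (h i) ⊆ member (c j) (h j) → i ≡ j
  ⊆⇒≡ p = let c≡ , h≡ = antichain p in h-inj c≡ h≡

-- Merging split antichains of both colours

MonochromaticSelection : ∀ {m} → (Fin m → Color) → ℕ → Color → Set
MonochromaticSelection {m} f s c =
  ∃ λ (g : Fin s → Fin m) → Injective _≡_ _≡_ g × (∀ i → f (g i) ≡ c)

weaken : ∀ {m} (f : Fin (suc m) → Color) {s c} →
         MonochromaticSelection (f ∘ suc) s c → MonochromaticSelection f s c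
weaken f (g , inj , eq) = suc ∘ g , inj ∘ Fin.suc-injective , eq

extend : ∀ {m} (f : Fin (suc m) → Color) {s c} → f zero ≡ c →
         MonochromaticSelection (f ∘ suc) s c → MonochromaticSelection f (suc s) c
extend f f0 (g , inj , eq) =
  zero Vector.∷ (suc ∘ g) , cons-injective (λ _ ()) (inj ∘ Fin.suc-injective) ,
  λ { zero → f0 ; (suc i) → eq i }

halve : ∀ {m} (f : Fin m → Color) c a b → a + b ≤ m →
        MonochromaticSelection f a c ⊎ MonochromaticSelection f b (opposite c)
halve f c zero b _ = inj₁ ((λ ()) , (λ { {()} }) , λ ())
halve f c (suc a) zero _ = inj₂ ((λ ()) , (λ { {()} }) , λ ())
halve {suc m} f c (suc a) (suc b) (s≤s ≤m) with f zero ≟ᶜ c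
... | yes f0 = Sum.map (extend f f0) (weaken f) (halve (f ∘ suc) c a (suc b) ≤m)
... | no ¬f0 = Sum.map (weaken f) (extend f (≢⇒≡opposite ¬f0))
                 (halve (f ∘ suc) c (suc a) b (≤-trans (≤-reflexive (sym (+-suc a b))) ≤m))

module _ {N} {χ : Subset N → Color} {s} (G : ∀ c → SplitAntichain χ c s)
         -- The inner and outer points of both colours take up `2 * (s + s)` places; as many fresh
         -- points mark `s + s` new sets for each colour.
         (large : 2 * (s + s) + 2 * (s + s) ≤ N) where

  private
    open module G c = SplitAntichain (G c)

    points : Color → List (Fin N)
    points c = List.tabulate (outer c) ++ List.tabulate (inner c)

    forbidden : List (Fin N)
    forbidden = points blue ++ points red

    length-points : ∀ c → length (points c) ≡ s + s
    length-points c = begin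
      length (points c)  ≡⟨ length-++ (List.tabulate (outer c)) ⟩
      length (List.tabulate (outer c)) + length (List.tabulate (inner c))
        ≡⟨ cong₂ _+_ (length-tabulate (outer c)) (length-tabulate (inner c)) ⟩
      s + s              ∎
      where open ≡-Reasoning

    length-forbidden : length forbidden ≡ 2 * (s + s)
    length-forbidden = begin
      length forbidden                            ≡⟨ length-++ (points blue) ⟩
      length (points blue) + length (points red)  ≡⟨ cong₂ _+_ (length-points blue) (length-points red) ⟩
      (s + s) + (s + s)                           ≡⟨ cong ((s + s) +_) (+-identityʳ (s + s)) ⟨
      2 * (s + s)                                 ∎
      where open ≡-Reasoning

    points⊆forbidden : ∀ c {z} → z List.∈ points c → z List.∈ forbidden
    points⊆forbidden blue = ∈-++⁺ˡ
    points⊆forbidden red  = ∈-++⁺ʳ (points blue)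

    outer∈forbidden : ∀ c i → outer c i List.∈ forbidden
    outer∈forbidden c i = points⊆forbidden c (∈-++⁺ˡ (∈-tabulate⁺ i))

    inner∈forbidden : ∀ c i → inner c i List.∈ forbidden
    inner∈forbidden c i = points⊆forbidden c (∈-++⁺ʳ (List.tabulate (outer c)) (∈-tabulate⁺ i))

    free : ∃ λ (f : Fin (2 * (s + s)) → Fin N) → Injective _≡_ _≡_ f × (∀ i → f i List.∉ forbidden)
    free = freshPoints _ forbidden
      (≤-trans (≤-reflexive (cong (2 * (s + s) +_) length-forbidden)) large)

    code : Color → Fin 2
    code blue = zero
    code red  = suc zero

    code-injective : ∀ {c d} → code c ≡ code d → c ≡ d
    code-injective {blue} {blue} _ = refl
    code-injective {red}  {red}  _ = refl

    F : Color → Fin (s + s) → Fin N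
    F c j = proj₁ free (combine (code c) j)

    F∉ : ∀ c j → F c j List.∉ forbidden
    F∉ c j = proj₂ (proj₂ free) _

    F-injective : ∀ {c d j k} → F c j ≡ F d k → c ≡ d × j ≡ k
    F-injective {c} {d} {j} {k} eq =
      let c≡ , j≡ = Fin.combine-injective (code c) j (code d) k (proj₁ (proj₂ free) eq)
      in code-injective c≡ , j≡

    W? : ∀ c j → Decidable (λ z → (∃ λ i → outer c i ≡ z) ⊎ F c j ≡ z)
    W? c j z = any? (λ i → outer c i Fin.≟ z) ⊎-dec (F c j Fin.≟ z)

    -- The outer points of colour `c` make this set incomparable to every `member c i`; its private
    -- fresh point makes all the sets `W` pairwise incomparable, also across colours.
    W : Color → Fin (s + s) → Subset N
    W c j = comprehension (W? c j)

    F∈W⇒≡ : ∀ {c d j k} → F c j ∈ W d k → c ≡ d × j ≡ k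
    F∈W⇒≡ {c} {d} {j} {k} F∈ with ∈-comprehension⁻ (W? d k) F∈
    ... | inj₁ (i , eq) = contradiction (subst (List._∈ forbidden) eq (outer∈forbidden d i)) (F∉ c j)
    ... | inj₂ eq       = F-injective (sym eq)

    W-antichain : ∀ {c d j k} → W c j ⊆ W d k → c ≡ d × j ≡ k
    W-antichain {c} {d} {j} W⊆ = F∈W⇒≡ (W⊆ (∈-comprehension⁺ (W? c j) (inj₂ refl)))

    inner∉W : ∀ c i j → inner c i ∉ W c j
    inner∉W c i j i∈ with ∈-comprehension⁻ (W? c j) i∈
    ... | inj₁ (k , eq) = outer≢inner c k i eq
    ... | inj₂ eq       = F∉ c j (subst (List._∈ forbidden) (sym eq) (inner∈forbidden c i))

    member⊈W : ∀ c i j → ¬ (member c i ⊆ W c j)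
    member⊈W c i j ⊆W = inner∉W c i j (⊆W (inner∈ c i))

    W⊈member : ∀ c j i → ¬ (W c j ⊆ member c i)
    W⊈member c j i W⊆ = outer∉ c i (W⊆ (∈-comprehension⁺ (W? c j) (inj₁ (i , refl))))

    -- Of the `s + s` sets `W c j`, either `s` have colour `c`, or `s` have the opposite colour and
    -- complete `member c` to a bicoloured antichain.
    rebalance : ∀ c → MonochromaticSelection (χ ∘ W c) s c ⊎ BicoloredAntichain χ s
    rebalance c with halve (χ ∘ W c) c s s ≤-refl
    ... | inj₁ sel = inj₁ sel
    ... | inj₂ (g , g-inj , col) = inj₂ (bicoloredAntichain c (member c) (W c ∘ g)
            (coloured c) col (antichain c) (λ p → g-inj (proj₂ (W-antichain p)))
            (λ i j → member⊈W c i (g j)) (λ j i → W⊈member c (g j) i))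

  bicolour : BicoloredAntichain χ s
  bicolour with rebalance blue | rebalance red
  ... | inj₂ A | _      = A
  ... | inj₁ _ | inj₂ A = A
  -- Here the new sets alone suffice: `s` blue ones among `W blue` and `s` red ones among `W red`.
  ... | inj₁ (g , g-inj , g-col) | inj₁ (h , h-inj , h-col) =
    bicoloredAntichain blue (W blue ∘ g) (W red ∘ h) g-col h-col
      (λ p → g-inj (proj₂ (W-antichain p))) (λ p → h-inj (proj₂ (W-antichain p)))
      (λ i j p → blue≢red (proj₁ (W-antichain p))) (λ i j p → blue≢red (sym (proj₁ (W-antichain p))))
    where
    blue≢red : blue ≢ red
    blue≢red ()

upperBound : ∀ {k n N s} (c : Fin k → Color) (h : Fin k → Fin s) →
  (∀ {i j} → c i ≡ c j → h i ≡ h j → i ≡ j) →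
  2 * (s + s) + 2 * (s + s) ≤ N →
  (∀ χ d → HasMonoCubeCopy n (opposite d) N χ ⊎ SplitAntichain χ d s) →
  Arrows k c n N
upperBound c h h-inj large cubeOrSplit χ with cubeOrSplit χ red | cubeOrSplit χ blue
... | inj₁ cube | _         = inj₂ (inj₁ cube)
... | inj₂ _    | inj₁ cube = inj₂ (inj₂ cube)
... | inj₂ r    | inj₂ b    =
  inj₁ (antichainCopy (bicolour (λ { blue → b ; red → r }) large) h h-inj)

-- Lower bounds

module _ {n N} (f : Subset n → Subset N) (f-mono : ∀ {S T} → S ⊆ T → f S ⊆ f T)
         (f-reflect : ∀ {S T} → f S ⊆ f T → S ⊆ T) where

  private
    separate : ∀ i → ∃ λ z → z ∈ f ⁅ i ⁆ × z ∉ f (∁ ⁅ i ⁆)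
    separate i = ⊈⇒∃ λ sub → x∈p⇒x∉∁p (x∈⁅x⁆ i) (f-reflect sub (x∈⁅x⁆ i))

  marker : Fin n → Fin N
  marker i = proj₁ (separate i)

  ∈⇒marker∈ : ∀ {i S} → i ∈ S → marker i ∈ f S
  ∈⇒marker∈ {i} {S} i∈S = f-mono
    (λ j∈ → subst (_∈ S) (sym (x∈⁅y⁆⇒x≡y i j∈)) i∈S) (proj₁ (proj₂ (separate i)))

  ∉⇒marker∉ : ∀ {i S} → i ∉ S → marker i ∉ f S
  ∉⇒marker∉ {i} {S} i∉S m∈ = proj₂ (proj₂ (separate i))
    (f-mono (λ j∈S → x∉p⇒x∈∁p λ j∈⁅i⁆ → i∉S (subst (_∈ S) (x∈⁅y⁆⇒x≡y i j∈⁅i⁆) j∈S)) m∈)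

  marker-injective : Injective _≡_ _≡_ marker
  marker-injective {i} {j} eq = decidable-stable (i Fin.≟ j) λ i≢j →
    ∉⇒marker∉ (λ i∈⁅j⁆ → i≢j (x∈⁅y⁆⇒x≡y j i∈⁅j⁆))
      (subst (_∈ f ⁅ j ⁆) (sym eq) (∈⇒marker∈ (x∈⁅x⁆ j)))

  module _ {x y} (x∈f⊥ : x ∈ f ⊥) (y∉f⊤ : y ∉ f ⊤) where

    private
      x≢marker : ∀ i → x ≢ marker i
      x≢marker i refl = ∉⇒marker∉ {i} ∉⊥ x∈f⊥

      y≢marker : ∀ i → y ≢ marker i
      y≢marker i refl = y∉f⊤ (∈⇒marker∈ ∈⊤)

      x∈f : ∀ S → x ∈ f S
      x∈f S = f-mono ⊥⊆ x∈f⊥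

      y∉f : ∀ S → y ∉ f S
      y∉f S = y∉f⊤ ∘ f-mono ⊆⊤

      x≢y : x ≢ y
      x≢y refl = y∉f⊤ (x∈f ⊤)

      points-injective : Injective _≡_ _≡_ (x Vector.∷ y Vector.∷ marker)
      points-injective = cons-injective (λ { zero → x≢y ; (suc i) → x≢marker i })
        (cons-injective y≢marker marker-injective)

    -- `x` lies in every image and `y` in none, whereas each marker lies in some images and not in
    -- others; hence all these points are distinct.
    2+n≤N : 2 + n ≤ N
    2+n≤N = injective⇒≤ points-injective

    -- With so few points, `x`, `y` and the markers exhaust `Fin N`, so `T` is determined by the
    -- markers it contains; `S` is the set of their indices.
    hitsInterval : N < 3 + n → ∀ {T} → x ∈ T → y ∉ T → ∃ λ S → f S ≡ T
    hitsInterval N<3+n {T} x∈T y∉T = S , ⊆-antisym fS⊆T T⊆fS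
      where
      S? : Decidable (λ i → marker i ∈ T)
      S? i = marker i ∈? T

      S : Subset n
      S = comprehension S?

      -- One more point would give `3 + n` distinct points of `Fin N`.
      classify : ∀ z → z ≡ x ⊎ z ≡ y ⊎ ∃ λ i → z ≡ marker i
      classify z = decidable-stable
        ((z Fin.≟ x) ⊎-dec (z Fin.≟ y) ⊎-dec any? (λ i → z Fin.≟ marker i)) λ new →
        <⇒≱ N<3+n (injective⇒≤ (cons-injective
          {x = z} {f = x Vector.∷ y Vector.∷ marker}
          (λ { zero → new ∘ inj₁ ; (suc zero) → new ∘ inj₂ ∘ inj₁
             ; (suc (suc i)) eq → new (inj₂ (inj₂ (i , eq))) })
          points-injective))

      fS⊆T : f S ⊆ T
      fS⊆T {z} z∈ with classify z
      ... | inj₁ refl              = x∈T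
      ... | inj₂ (inj₁ refl)       = contradiction z∈ (y∉f S)
      ... | inj₂ (inj₂ (i , refl)) = decidable-stable (marker i ∈? T) λ m∉T →
              ∉⇒marker∉ (m∉T ∘ ∈-comprehension⁻ S?) z∈

      T⊆fS : T ⊆ f S
      T⊆fS {z} z∈ with classify z
      ... | inj₁ refl              = x∈f S
      ... | inj₂ (inj₁ refl)       = contradiction z∈ y∉T
      ... | inj₂ (inj₂ (i , refl)) = ∈⇒marker∈ (∈-comprehension⁺ S? z∈)

-- Segments and trivial sets

IsDownSet IsUpSet : ∀ {N} → Subset N → Set
IsDownSet S = ∀ a b → a Fin.≤ b → b ∈ S → a ∈ S
IsUpSet   S = ∀ a b → a Fin.≤ b → a ∈ S → b ∈ S

isDownSet? : ∀ {N} → Decidable (IsDownSet {N})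
isDownSet? S = all? λ a → all? λ b → (a Fin.≤? b) →-dec (b ∈? S) →-dec (a ∈? S)

isUpSet? : ∀ {N} → Decidable (IsUpSet {N})
isUpSet? S = all? λ a → all? λ b → (a Fin.≤? b) →-dec (a ∈? S) →-dec (b ∈? S)

downSets-chain : ∀ {N} {S T : Subset N} → IsDownSet S → IsDownSet T → S ⊆ T ⊎ T ⊆ S
downSets-chain {S = S} {T} downS downT with S ⊆? T
... | yes S⊆T = inj₁ S⊆T
... | no S⊈T with a , a∈S , a∉T ← ⊈⇒∃ S⊈T = inj₂ λ {b} b∈T → downS b a
  ([ id , (λ a≤b → contradiction (downT a b a≤b b∈T) a∉T) ]′ (Fin.≤-total b a)) a∈S

upSets-chain : ∀ {N} {S T : Subset N} → IsUpSet S → IsUpSet T → S ⊆ T ⊎ T ⊆ S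
upSets-chain {S = S} {T} upS upT with S ⊆? T
... | yes S⊆T = inj₁ S⊆T
... | no S⊈T with a , a∈S , a∉T ← ⊈⇒∃ S⊈T = inj₂ λ {b} b∈T → upS a b
  ([ id , (λ b≤a → contradiction (upT b a b≤a b∈T) a∉T) ]′ (Fin.≤-total a b)) a∈S

IsSegment : ∀ {N} → Subset N → Set
IsSegment S = IsDownSet S ⊎ IsUpSet S

isSegment? : ∀ {N} → Decidable (IsSegment {N})
isSegment? S = isDownSet? S ⊎-dec isUpSet? S

Comparable : ∀ {N} → Subset N → Subset N → Set
Comparable S T = S ⊆ T ⊎ T ⊆ S

-- Initial segments form a chain and so do final segments; two of the three sets are of the same
-- kind.
three-segments : ∀ {N} {S T U : Subset N} → IsSegment S → IsSegment T → IsSegment U →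
                 Comparable S T ⊎ Comparable S U ⊎ Comparable T U
three-segments (inj₁ s) (inj₁ t) _        = inj₁ (downSets-chain s t)
three-segments (inj₂ s) (inj₂ t) _        = inj₁ (upSets-chain s t)
three-segments (inj₁ s) (inj₂ t) (inj₁ u) = inj₂ (inj₁ (downSets-chain s u))
three-segments (inj₁ s) (inj₂ t) (inj₂ u) = inj₂ (inj₂ (upSets-chain t u))
three-segments (inj₂ s) (inj₁ t) (inj₁ u) = inj₂ (inj₂ (downSets-chain t u))
three-segments (inj₂ s) (inj₁ t) (inj₂ u) = inj₂ (inj₁ (upSets-chain s u))

antichain-¬segments : ∀ {N} (g : Fin 3 → Subset N) → (∀ {i j} → g i ⊆ g j → i ≡ j) →
                      ¬ (∀ i → IsSegment (g i))
antichain-¬segments g anti seg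
  with three-segments (seg zero) (seg (suc zero)) (seg (suc (suc zero)))
... | inj₁ (inj₁ p)        = contradiction (anti p) λ ()
... | inj₁ (inj₂ p)        = contradiction (anti p) λ ()
... | inj₂ (inj₁ (inj₁ p)) = contradiction (anti p) λ ()
... | inj₂ (inj₁ (inj₂ p)) = contradiction (anti p) λ ()
... | inj₂ (inj₂ (inj₁ p)) = contradiction (anti p) λ ()
... | inj₂ (inj₂ (inj₂ p)) = contradiction (anti p) λ ()

-- Cut the order at `x`: take the points up to `x` if `x` precedes `y`, and the points from `x` on
-- otherwise.
separatingSegment : ∀ {N} {x y : Fin N} → x ≢ y → ∃ λ T → IsSegment T × x ∈ T × y ∉ T
separatingSegment {x = x} {y} x≢y with Fin.<-cmp x y
... | tri≈ _ x≡y _ = contradiction x≡y x≢y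
... | tri< x<y _ _ = comprehension ≤x? ,
      inj₁ (λ a b a≤b b∈ → ∈-comprehension⁺ ≤x? (Fin.≤-trans a≤b (∈-comprehension⁻ ≤x? b∈))) ,
      ∈-comprehension⁺ ≤x? Fin.≤-refl , λ y∈ → <⇒≱ x<y (∈-comprehension⁻ ≤x? y∈)
  where
  ≤x? : Decidable (Fin._≤ x)
  ≤x? z = z Fin.≤? x
... | tri> _ _ y<x = comprehension x≤? ,
      inj₂ (λ a b a≤b a∈ → ∈-comprehension⁺ x≤? (Fin.≤-trans (∈-comprehension⁻ x≤? a∈) a≤b)) ,
      ∈-comprehension⁺ x≤? Fin.≤-refl , λ y∈ → <⇒≱ y<x (∈-comprehension⁻ x≤? y∈)
  where
  x≤? : Decidable (x Fin.≤_)
  x≤? z = x Fin.≤? z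

-- Stated through inclusions, so that for a nontrivial set `⊈⇒∃` yields a point inside and a point
-- outside.
IsTrivial : ∀ {N} → Subset N → Set
IsTrivial S = S ⊆ ⊥ ⊎ ⊤ ⊆ S

isTrivial? : ∀ {N} → Decidable (IsTrivial {N})
isTrivial? S = (S ⊆? ⊥) ⊎-dec (⊤ ⊆? S)

trivial⇒segment : ∀ {N} {S : Subset N} → IsTrivial S → IsSegment S
trivial⇒segment (inj₁ S⊆⊥) = inj₁ λ _ _ _ b∈S → contradiction (S⊆⊥ b∈S) ∉⊥
trivial⇒segment (inj₂ ⊤⊆S) = inj₁ λ _ _ _ _ → ⊤⊆S ∈⊤

trivial⇒comparable : ∀ {N} {S : Subset N} → IsTrivial S → ∀ T → Comparable S T
trivial⇒comparable (inj₁ S⊆⊥) T = inj₁ (⊆-trans S⊆⊥ ⊥⊆)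
trivial⇒comparable (inj₂ ⊤⊆S) T = inj₂ (⊆-trans ⊆⊤ ⊤⊆S)

-- Colourings without monochromatic cubes

module _ {N} {P : Pred (Subset N) 0ℓ} (P? : Decidable P) (c : Color) where

  indicator : Subset N → Color
  indicator S = if does (P? S) then c else opposite c

  indicator≡⇒ : ∀ S → indicator S ≡ c → P S
  indicator≡⇒ S eq with P? S
  ... | yes pS = pS
  ... | no _   = contradiction eq (opposite≢ c)

  indicator≡opposite⇒ : ∀ S → indicator S ≡ opposite c → ¬ P S
  indicator≡opposite⇒ S eq with P? S
  ... | yes _  = contradiction (sym eq) (opposite≢ c)
  ... | no ¬pS = ¬pS

  -- The separating sets are requested only if `2 + n ≤ N`, which lets one argument serve both
  -- colourings: for trivial sets, `N < 2 + n` makes this request vacuous.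
  ¬cube : (∀ {S} → P S → IsSegment S) → (∀ {S} → IsTrivial S → P S) →
          ∀ {n} → 3 ≤ n → N < 3 + n →
          (2 + n ≤ N → ∀ {x y} → x ≢ y → ∃ λ T → P T × x ∈ T × y ∉ T) →
          ∀ d → ¬ HasMonoCubeCopy n d N indicator
  ¬cube P⇒segment trivial⇒P {n} 3≤n N<3+n separating d (f , (_ , emb) , col) with d ≟ᶜ c
  -- In colour `c`, the images of three singletons would be an antichain of segments.
  ... | yes refl = antichain-¬segments (λ i → f ⁅ inject≤ i 3≤n ⁆)
          (λ p → Fin.inject≤-injective 3≤n 3≤n _ _
                   (x∈⁅y⁆⇒x≡y _ (Equivalence.from (emb _ _) p (x∈⁅x⁆ _))))
          (λ i → P⇒segment (indicator≡⇒ _ (col _)))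
  -- In the other colour, `f ⊥` and `f ⊤` are nontrivial, so the image fills an interval, which
  -- contains a set satisfying `P`.
  ... | no d≢c =
    let x , x∈f⊥ , _ = ⊈⇒∃ (λ f⊥⊆⊥ → ¬P ⊥ (trivial⇒P (inj₁ f⊥⊆⊥)))
        y , _ , y∉f⊤ = ⊈⇒∃ (λ ⊤⊆f⊤ → ¬P ⊤ (trivial⇒P (inj₂ ⊤⊆f⊤)))
        T , pT , x∈T , y∉T = separating (2+n≤N f mono reflect x∈f⊥ y∉f⊤) λ x≡y →
          y∉f⊤ (subst (_∈ f ⊤) x≡y (mono ⊥⊆ x∈f⊥))
        S , fS≡T = hitsInterval f mono reflect x∈f⊥ y∉f⊤ N<3+n x∈T y∉T
    in ¬P S (subst P (sym fS≡T) pT)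
    where
    mono : ∀ {S T} → S ⊆ T → f S ⊆ f T
    mono = Equivalence.to (emb _ _)
    reflect : ∀ {S T} → f S ⊆ f T → S ⊆ T
    reflect = Equivalence.from (emb _ _)
    ¬P : ∀ S → ¬ P (f S)
    ¬P S = indicator≡opposite⇒ (f S) (trans (col S) (≢⇒≡opposite d≢c))

-- The vertex `i` would have to be a trivial set, which is comparable to the image of `j`.
¬arrows-n+1 : ∀ {k n N} {c : Fin k → Color} → NotMonochromatic c → 3 ≤ n → N < 2 + n →
              ¬ Arrows k c n N
¬arrows-n+1 {n = n} {N} {c} (i , j , ci≢cj) 3≤n N<2+n arrows
  with arrows (indicator isTrivial? (c i))
... | inj₂ cubes = [ noCube blue , noCube red ]′ cubes
  where
  noCube : ∀ d → ¬ HasMonoCubeCopy n d N (indicator isTrivial? (c i))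
  noCube = ¬cube isTrivial? (c i) trivial⇒segment id 3≤n (m≤n⇒m≤1+n N<2+n)
             (λ 2+n≤N → contradiction 2+n≤N (<⇒≱ N<2+n))
... | inj₁ (f , (_ , emb) , col) = ci≢cj (cong c i≡j)
  where
  i≡j : i ≡ j
  i≡j with trivial⇒comparable (indicator≡⇒ isTrivial? (c i) (f i) (col i)) (f j)
  ... | inj₁ fi⊆fj = Equivalence.from (emb i j) fi⊆fj
  ... | inj₂ fj⊆fi = sym (Equivalence.from (emb j i) fj⊆fi)

¬arrows-n+2 : ∀ {k n N} {c : Fin k → Color} → HasThreeSameColor c → 3 ≤ n → N < 3 + n →
              ¬ Arrows k c n N
¬arrows-n+2 {k} {n} {N} {c} (i , j , l , i≢j , i≢l , j≢l , ci≡cj , ci≡cl) 3≤n N<3+n arrows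
  with arrows (indicator isSegment? (c i))
... | inj₂ cubes = [ noCube blue , noCube red ]′ cubes
  where
  noCube : ∀ d → ¬ HasMonoCubeCopy n d N (indicator isSegment? (c i))
  noCube = ¬cube isSegment? (c i) id trivial⇒segment 3≤n N<3+n (λ _ → separatingSegment)
... | inj₁ (f , (_ , emb) , col) = antichain-¬segments (f ∘ v)
        (λ p → v-injective (Equivalence.from (emb _ _) p))
        (λ t → indicator≡⇒ isSegment? (c i) _ (trans (col (v t)) (v-color t)))
  where
  v : Fin 3 → Fin k
  v = i Vector.∷ j Vector.∷ l Vector.∷ Vector.[]
  v-injective : Injective _≡_ _≡_ v
  v-injective = cons-injective (λ { zero → i≢j ; (suc zero) → i≢l })
    (cons-injective (λ { zero → j≢l }) λ { {zero} {zero} _ → refl })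
  v-color : ∀ t → c (v t) ≡ c i
  v-color zero             = refl
  v-color (suc zero)       = sym ci≡cj
  v-color (suc (suc zero)) = sym ci≡cl

-- Upper bound n + 2

module _ {N} {χ : Subset N → Color} {c}
         (hit : ∀ x y → x ≢ y → ∃ λ R → χ R ≡ c × x ∈ R × y ∉ R) where

  private
    splitPair : ∀ {A B} → χ A ≡ c → χ B ≡ c → ∀ {a a′ b b′} →
                a ∈ A → a′ ∉ A → b ∈ B → b′ ∉ B →
                a′ ≢ a → a′ ≢ b → b′ ≢ a → b′ ≢ b →
                ¬ (A ⊆ B) → ¬ (B ⊆ A) → SplitAntichain χ c 2
    splitPair {A} {B} χA χB {a} {a′} {b} {b′} a∈ a′∉ b∈ b′∉ a′≢a a′≢b b′≢a b′≢b A⊈B B⊈A = record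
      { member      = λ { zero → A ; (suc zero) → B }
      ; coloured    = λ { zero → χA ; (suc zero) → χB }
      ; antichain   = λ { {zero} {zero} _ → refl ; {suc zero} {suc zero} _ → refl
                        ; {zero} {suc zero} p → contradiction (λ {x} → p {x}) A⊈B
                        ; {suc zero} {zero} p → contradiction (λ {x} → p {x}) B⊈A }
      ; inner       = λ { zero → a ; (suc zero) → b }
      ; outer       = λ { zero → a′ ; (suc zero) → b′ }
      ; inner∈      = λ { zero → a∈ ; (suc zero) → b∈ }
      ; outer∉      = λ { zero → a′∉ ; (suc zero) → b′∉ }
      ; outer≢inner = λ { zero zero → a′≢a ; zero (suc zero) → a′≢b
                        ; (suc zero) zero → b′≢a ; (suc zero) (suc zero) → b′≢b } }

    splitWithOutsider : ∀ {A B} → χ A ≡ c → χ B ≡ c → ∀ {x y z} →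
                        x ∈ A → x ∉ B → y ∈ B → y ∉ A → z ∉ A → z ∉ B → SplitAntichain χ c 2
    splitWithOutsider χA χB x∈A x∉B y∈B y∉A z∉A z∉B =
      splitPair χA χB x∈A z∉A y∈B z∉B (∉-∈⇒≢ z∉A x∈A) (∉-∈⇒≢ z∉B y∈B) (∉-∈⇒≢ z∉A x∈A) (∉-∈⇒≢ z∉B y∈B)
        (λ A⊆B → x∉B (A⊆B x∈A)) (λ B⊆A → y∉A (B⊆A y∈B))

    -- The set containing x but not y and the set containing y but not x extend to a split
    -- antichain unless they are a singleton and its complement.
    splitOrSingleton : ∀ {x y} → x ≢ y → SplitAntichain χ c 2 ⊎ χ ⁅ x ⁆ ≡ c ⊎ χ ⁅ y ⁆ ≡ c
    splitOrSingleton {x} {y} x≢y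
      with A , χA , x∈A , y∉A ← hit x y x≢y
         | B , χB , y∈B , x∉B ← hit y x (x≢y ∘ sym)
      with any? (λ z → ¬? (z ∈? A) ×-dec ¬? (z ∈? B))
    ... | yes (z , z∉A , z∉B) = inj₁ (splitWithOutsider χA χB x∈A x∉B y∈B y∉A z∉A z∉B)
    ... | no _ with any? (λ z → (z ∈? A) ×-dec (z ∈? B))
    -- The common point `z` is inner for both sets, with `y` outer for `A` and `x` outer for `B`.
    ... | yes (z , z∈A , z∈B) =
          inj₁ (splitPair χA χB z∈A y∉A z∈B x∉B (∉-∈⇒≢ y∉A z∈A) (∉-∈⇒≢ y∉A z∈A) (∉-∈⇒≢ x∉B z∈B) (∉-∈⇒≢ x∉B z∈B)
            (λ A⊆B → x∉B (A⊆B x∈A)) (λ B⊆A → y∉A (B⊆A y∈B)))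
    ... | no disjoint
      with any? (λ a → (a ∈? A) ×-dec ¬? (a Fin.≟ x)) | any? (λ b → (b ∈? B) ×-dec ¬? (b Fin.≟ y))
    -- `A` and `B` are disjoint here, so a second point of each set is an outer point for the other.
    ... | yes (a , a∈A , a≢x) | yes (b , b∈B , b≢y) =
          inj₁ (splitPair χA χB x∈A (λ b∈A → disjoint (b , b∈A , b∈B)) y∈B (λ a∈B → disjoint (a , a∈A , a∈B))
            (∉-∈⇒≢ x∉B b∈B ∘ sym) b≢y a≢x (∉-∈⇒≢ y∉A a∈A ∘ sym)
            (λ A⊆B → x∉B (A⊆B x∈A)) (λ B⊆A → y∉A (B⊆A y∈B)))
    ... | no A⊆x | _ = inj₂ (inj₁ (subst (λ S → χ S ≡ c) (singleton x∈A A⊆x) χA))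
    ... | yes _ | no B⊆y = inj₂ (inj₂ (subst (λ S → χ S ≡ c) (singleton y∈B B⊆y) χB))

    splitSingletons : ∀ {x y z} → x ≢ y → x ≢ z → y ≢ z → χ ⁅ x ⁆ ≡ c → χ ⁅ y ⁆ ≡ c → SplitAntichain χ c 2
    splitSingletons {x} {y} {z} x≢y x≢z y≢z χx χy =
      splitWithOutsider χx χy (x∈⁅x⁆ x) (x≢y ∘ x∈⁅y⁆⇒x≡y y) (x∈⁅x⁆ y) (x≢y ∘ sym ∘ x∈⁅y⁆⇒x≡y x)
        (x≢z ∘ sym ∘ x∈⁅y⁆⇒x≡y x) (y≢z ∘ sym ∘ x∈⁅y⁆⇒x≡y y)

  -- Among three points, every pair gives a split antichain or a singleton of colour `c`. Failing
  -- the former, two of the singletons have colour `c`, and the third point is outside both.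
  pairHits⇒split : 3 ≤ N → SplitAntichain χ c 2
  pairHits⇒split (s≤s (s≤s (s≤s _))) = from {zero} {suc zero} {suc (suc zero)} (λ ()) (λ ()) (λ ())
    where
    from : ∀ {x y z} → x ≢ y → x ≢ z → y ≢ z → SplitAntichain χ c 2
    from x≢y x≢z y≢z with splitOrSingleton x≢y
    ... | inj₁ split = split
    ... | inj₂ (inj₁ χx) with splitOrSingleton y≢z
    ...   | inj₁ split      = split
    ...   | inj₂ (inj₁ χy) = splitSingletons x≢y x≢z y≢z χx χy
    ...   | inj₂ (inj₂ χz) = splitSingletons x≢z x≢y (y≢z ∘ sym) χx χz
    from x≢y x≢z y≢z | inj₂ (inj₂ χy) with splitOrSingleton x≢z
    ...   | inj₁ split      = split
    ...   | inj₂ (inj₁ χx) = splitSingletons x≢y x≢z y≢z χx χy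
    ...   | inj₂ (inj₂ χz) = splitSingletons y≢z (x≢y ∘ sym) (x≢z ∘ sym) χy χz

cubeOrSplit-n+2 : ∀ {n N} → 3 ≤ N → n + 2 ≤ N → (χ : Subset N → Color) → ∀ c →
                  HasMonoCubeCopy n (opposite c) N χ ⊎ SplitAntichain χ c 2
cubeOrSplit-n+2 3≤N n+2≤N χ c =
  Sum.map₂ (λ hit → pairHits⇒split hit 3≤N) (collect λ x → collect λ y → pairHit x y)
  where
  pairHit : ∀ x y → _ ⊎ (x ≢ y → ∃ λ R → χ R ≡ c × x ∈ R × y ∉ R)
  pairHit x y with x Fin.≟ y
  ... | yes x≡y = inj₂ λ x≢y → contradiction x≡y x≢y
  ... | no x≢y with cubeOrHit χ (opposite c) x (y ∷ []) (x≢y ∷ []) n+2≤N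
  ... | inj₁ cube = inj₁ cube
  ... | inj₂ (R , χR , x∈R , y∉R ∷ []) = inj₂ λ _ → R , trans χR (opposite-involutive c) , x∈R , y∉R

-- Ramsey's theorem for pairs

module _ {A : Set} where

  AllPairs-resp-⊑ : ∀ {R : Rel A 0ℓ} {xs ys} → xs ⊑ ys → AllPairs R ys → AllPairs R xs
  AllPairs-resp-⊑ []         []         = []
  AllPairs-resp-⊑ (_ ∷ʳ sub) (_ ∷ rs)   = AllPairs-resp-⊑ sub rs
  AllPairs-resp-⊑ (refl ∷ sub) (r ∷ rs) = All-resp-⊆ sub r ∷ AllPairs-resp-⊑ sub rs

  AllPairs-lookup : ∀ {R : Rel A 0ℓ} {xs} → Symmetric R → AllPairs R xs →
                    ∀ {i j} → i ≢ j → R (lookup xs i) (lookup xs j)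
  AllPairs-lookup sym (r ∷ rs) {zero}  {zero}  i≢j = contradiction refl i≢j
  AllPairs-lookup sym (r ∷ rs) {zero}  {suc j} i≢j = All.lookup r (∈-lookup j)
  AllPairs-lookup sym (r ∷ rs) {suc i} {zero}  i≢j = sym (All.lookup r (∈-lookup i))
  AllPairs-lookup sym (r ∷ rs) {suc i} {suc j} i≢j = AllPairs-lookup sym rs (i≢j ∘ cong suc)

  split : ∀ {P : Pred A 0ℓ} → Decidable P → ∀ xs → ∃₂ λ ys zs →
          ys ⊑ xs × zs ⊑ xs × All P ys × All (¬_ ∘ P) zs × length xs ≡ length ys + length zs
  split P? [] = [] , [] , [] , [] , [] , [] , refl
  split P? (x ∷ xs) with split P? xs | P? x
  ... | ys , zs , ys⊑ , zs⊑ , pys , pzs , eq | yes px =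
        x ∷ ys , zs , refl ∷ ys⊑ , x ∷ʳ zs⊑ , px ∷ pys , pzs , cong suc eq
  ... | ys , zs , ys⊑ , zs⊑ , pys , pzs , eq | no ¬px =
        ys , x ∷ zs , x ∷ʳ ys⊑ , refl ∷ zs⊑ , pys , ¬px ∷ pzs , trans (cong suc eq) (sym (+-suc _ _))

  LongSublist : (R : Rel A 0ℓ) → ℕ → List A → Set
  LongSublist R m xs = ∃ λ ys → ys ⊑ xs × m ≤ length ys × AllPairs R ys

  longSublist-resp : ∀ {R : Rel A 0ℓ} {m xs ys} → xs ⊑ ys → LongSublist R m xs → LongSublist R m ys
  longSublist-resp xs⊑ys (zs , zs⊑xs , m≤ , rs) = zs , Sublist.⊆-trans zs⊑xs xs⊑ys , m≤ , rs

  longSublist-∷ : ∀ {R : Rel A 0ℓ} {m x xs ys} → xs ⊑ ys → All (R x) xs →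
                  LongSublist R m xs → LongSublist R (suc m) (x ∷ ys)
  longSublist-∷ xs⊑ys r (zs , zs⊑xs , m≤ , rs) =
    _ ∷ zs , refl ∷ Sublist.⊆-trans zs⊑xs xs⊑ys , s≤s m≤ , All-resp-⊆ zs⊑xs r ∷ rs

-- A sufficient length from the usual recursion, not the exact Ramsey number.
ramseyNumber : ℕ → ℕ → ℕ
ramseyNumber zero    _       = 0
ramseyNumber (suc a) zero    = 0
ramseyNumber (suc a) (suc b) = suc (ramseyNumber a (suc b) + ramseyNumber (suc a) b)

≤-sum-cases : ∀ {a b c d} → a + b ≤ c + d → a ≤ c ⊎ b ≤ d
≤-sum-cases {a} {b} {c} {d} le with a ≤? c | b ≤? d
... | yes a≤c | _       = inj₁ a≤c
... | no _    | yes b≤d = inj₂ b≤d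
... | no a≰c  | no b≰d  = contradiction le (<⇒≱ (+-mono-< (≰⇒> a≰c) (≰⇒> b≰d)))

-- The tail is split by its relation to the head `x`, and one part is long enough for induction.
-- Pairs are compared in list order, so `R` may be asymmetric.
ramsey : ∀ {A : Set} {R : Rel A 0ℓ} → Decidable₂ R → ∀ a b xs → ramseyNumber a b ≤ length xs →
         LongSublist R a xs ⊎ LongSublist (λ x y → ¬ R x y) b xs
ramsey R? zero    b       xs _ = inj₁ ([] , Sublist.minimum xs , z≤n , [])
ramsey R? (suc a) zero    xs _ = inj₂ ([] , Sublist.minimum xs , z≤n , [])
ramsey R? (suc a) (suc b) (x ∷ xs) (s≤s le)
  with ys , zs , ys⊑ , zs⊑ , pys , pzs , eq ← split (R? x) xs
  with ≤-sum-cases {ramseyNumber a (suc b)} (≤-trans le (≤-reflexive eq))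
... | inj₁ le₁ = Sum.map (longSublist-∷ ys⊑ pys) (longSublist-resp (x ∷ʳ ys⊑)) (ramsey R? a (suc b) ys le₁)
... | inj₂ le₂ = Sum.map (longSublist-resp (x ∷ʳ zs⊑)) (longSublist-∷ zs⊑ pzs) (ramsey R? (suc a) b zs le₂)

iteratedRamsey : ℕ → ℕ → ℕ
iteratedRamsey zero    m = m
iteratedRamsey (suc t) m = ramseyNumber (iteratedRamsey t m) (iteratedRamsey t m)

Homogeneous : ∀ {A : Set} → Rel A 0ℓ → List A → Set
Homogeneous R xs = AllPairs R xs ⊎ AllPairs (λ x y → ¬ R x y) xs

homogeneous-resp : ∀ {A : Set} {R : Rel A 0ℓ} {xs ys} → xs ⊑ ys → Homogeneous R ys → Homogeneous R xs
homogeneous-resp sub = Sum.map (AllPairs-resp-⊑ sub) (AllPairs-resp-⊑ sub)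

ramsey-homogeneous : ∀ {A : Set} {R : Rel A 0ℓ} → Decidable₂ R → ∀ m xs → ramseyNumber m m ≤ length xs →
                     ∃ λ ys → ys ⊑ xs × m ≤ length ys × Homogeneous R ys
ramsey-homogeneous R? m xs le with ramsey R? m m xs le
... | inj₁ (ys , ys⊑ , m≤ , rs) = ys , ys⊑ , m≤ , inj₁ rs
... | inj₂ (ys , ys⊑ , m≤ , rs) = ys , ys⊑ , m≤ , inj₂ rs

-- Sublists inherit homogeneity, so the relations are treated one after another.
homogenise : ∀ {A : Set} (R : ℕ → Rel A 0ℓ) → (∀ i → Decidable₂ (R i)) → ∀ t m xs →
             iteratedRamsey t m ≤ length xs →
             ∃ λ ys → ys ⊑ xs × m ≤ length ys × (∀ {i} → i < t → Homogeneous (R i) ys)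
homogenise R R? zero    m xs le = xs , Sublist.⊆-refl , le , λ ()
homogenise R R? (suc t) m xs le
  with ys , ys⊑xs , b≤ , hom ← ramsey-homogeneous (R? t) (iteratedRamsey t m) xs le
  with zs , zs⊑ys , m≤ , homs ← homogenise R R? t m ys b≤ =
  zs , Sublist.⊆-trans zs⊑ys ys⊑xs , m≤ , extended
  where
  extended : ∀ {i} → i < suc t → Homogeneous (R i) zs
  extended i<1+t with m<1+n⇒m<n∨m≡n i<1+t
  ... | inj₁ i<t  = homs i<t
  ... | inj₂ refl = homogeneous-resp zs⊑ys hom

-- Upper bound n + 3

-- Covers of different lengths are padded with ⊤, which avoids no point.
nthOr⊤ : ∀ {N} → List (Subset N) → ℕ → Subset N
nthOr⊤ []       _       = ⊤
nthOr⊤ (S ∷ Ss) zero    = S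
nthOr⊤ (S ∷ Ss) (suc i) = nthOr⊤ Ss i

∉nthOr⊤⇒∈ : ∀ {N} (Ss : List (Subset N)) i {x} → x ∉ nthOr⊤ Ss i → nthOr⊤ Ss i List.∈ Ss
∉nthOr⊤⇒∈ []       i       x∉ = contradiction ∈⊤ x∉
∉nthOr⊤⇒∈ (S ∷ Ss) zero    x∉ = here refl
∉nthOr⊤⇒∈ (S ∷ Ss) (suc i) x∉ = there (∉nthOr⊤⇒∈ Ss i x∉)

Any⇒nthOr⊤ : ∀ {N} {P : Pred (Subset N) 0ℓ} {Ss} → Any P Ss → ∃ λ i → i < length Ss × P (nthOr⊤ Ss i)
Any⇒nthOr⊤ (here px)   = 0 , s≤s z≤n , px
Any⇒nthOr⊤ (there any) = let i , i< , pi = Any⇒nthOr⊤ any in suc i , s≤s i< , pi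

AvoidsBoth : ∀ {N} → Fin N → Fin N → Pred (Subset N) 0ℓ
AvoidsBoth y z A = y ∉ A × z ∉ A

module _ {N} {χ : Subset N → Color} {c}
         (hit : ∀ x y z → x ≢ y → x ≢ z → ∃ λ R → χ R ≡ c × x ∈ R × AvoidsBoth y z R) where

  private
    Minimal : Fin N → Pred (Subset N) 0ℓ
    Minimal x A = χ A ≡ c × x ∈ A × (∀ B → χ B ≡ c → x ∈ B → B ⊆ A → A ⊆ B)

    minimise : ∀ {x} A → Acc _<_ ∣ A ∣ → χ A ≡ c → x ∈ A → ∃ λ B → B ⊆ A × Minimal x B
    minimise {x} A (acc rs) χA x∈A
      with anySubset? (λ B → (χ B ≟ᶜ c) ×-dec (x ∈? B) ×-dec (B ⊆? A) ×-dec ¬? (A ⊆? B))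
    ... | no ¬smaller = A , ⊆-refl , χA , x∈A , λ B χB x∈B B⊆A →
            decidable-stable (A ⊆? B) λ A⊈B → ¬smaller (B , χB , x∈B , B⊆A , A⊈B)
    ... | yes (B , χB , x∈B , B⊆A , A⊈B)
      with C , C⊆B , min ← minimise B (rs (p⊂q⇒∣p∣<∣q∣ (B⊆A , ⊈⇒∃ A⊈B))) χB x∈B =
      C , ⊆-trans C⊆B B⊆A , min

    Incomparable : Rel (Subset N) 0ℓ
    Incomparable A B = ¬ (A ⊆ B) × ¬ (B ⊆ A)

    Cover : ℕ → Fin N → Set
    Cover s x = ∃ λ ms → length ms ≤ s × All (λ A → χ A ≡ c × x ∈ A) ms ×
                (∀ {y z} → x ≢ y → x ≢ z → Any (AvoidsBoth y z) ms)

    -- All members contain `x`, which serves as the common inner point.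
    minimalAntichain⇒split : ∀ {x} ms → AllPairs Incomparable ms →
                             All (λ A → Minimal x A × ∃ λ y → y ∉ A) ms → SplitAntichain χ c (length ms)
    minimalAntichain⇒split {x} ms inc props = record
      { member      = lookup ms
      ; coloured    = λ i → proj₁ (proj₁ (prop i))
      ; antichain   = λ {i} {j} p → decidable-stable (i Fin.≟ j) λ i≢j →
                        proj₁ (AllPairs-lookup (λ (u , v) → v , u) inc i≢j) p
      ; inner       = λ _ → x
      ; outer       = λ i → proj₁ (proj₂ (prop i))
      ; inner∈      = λ i → proj₁ (proj₂ (proj₁ (prop i)))
      ; outer∉      = λ i → proj₂ (proj₂ (prop i))
      ; outer≢inner = λ i _ → ∉-∈⇒≢ (proj₂ (proj₂ (prop i))) (proj₁ (proj₂ (proj₁ (prop i)))) }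
      where
      prop : ∀ i → Minimal x (lookup ms i) × ∃ λ y → y ∉ lookup ms i
      prop i = All.lookup props (∈-lookup i)

    -- Greedy construction: while some pair `y`, `z` is not avoided, a minimal set below a hit for
    -- that pair joins `ms`; `t` counts the sets still wanted.
    splitOrCover : ∀ {s} x t ms → length ms + t ≡ s → AllPairs Incomparable ms →
                   All (λ A → Minimal x A × ∃ λ y → y ∉ A) ms → SplitAntichain χ c s ⊎ Cover s x
    splitOrCover x zero ms refl inc props =
      inj₁ (subst (SplitAntichain χ c) (sym (+-identityʳ _)) (minimalAntichain⇒split ms inc props))
    splitOrCover x (suc t) ms refl inc props
      with any? (λ y → any? λ z → ¬? (x Fin.≟ y) ×-dec ¬? (x Fin.≟ z) ×-dec ¬? (avoided? y z))
      where
      avoided? : ∀ y z → Dec (Any (AvoidsBoth y z) ms)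
      avoided? y z = Any.any? (λ A → ¬? (y ∈? A) ×-dec ¬? (z ∈? A)) ms
    ... | no ¬uncovered = inj₂ (ms , m≤m+n _ _ ,
            All.map (λ ((χA , x∈A , _) , _) → χA , x∈A) props ,
            λ x≢y x≢z → decidable-stable (Any.any? (λ A → ¬? (_ ∈? A) ×-dec ¬? (_ ∈? A)) ms) λ ¬any →
              ¬uncovered (_ , _ , x≢y , x≢z , ¬any))
    ... | yes (y , z , x≢y , x≢z , ¬any)
      with R , χR , x∈R , y∉R , z∉R ← hit x y z x≢y x≢z
      with A , A⊆R , min@(χA , x∈A , _) ← minimise R (<-wellFounded _) χR x∈R =
      splitOrCover x t (A ∷ ms) (sym (+-suc _ _))
        (All.tabulate new ∷ inc) ((min , y , y∉R ∘ A⊆R) ∷ props)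
      where
      -- `B ⊆ A` would make `B` avoid the pair, and `A ⊆ B` reduces to this by minimality of `B`.
      new : ∀ {B} → B List.∈ ms → Incomparable A B
      new {B} B∈ms = A⊈B , B⊈A
        where
        B⊈A : ¬ (B ⊆ A)
        B⊈A B⊆A = ¬any (List.lose B∈ms (y∉R ∘ A⊆R ∘ B⊆A , z∉R ∘ A⊆R ∘ B⊆A))
        A⊈B : ¬ (A ⊆ B)
        A⊈B A⊆B = B⊈A (proj₂ (proj₂ (proj₁ (All.lookup props B∈ms))) A χA x∈A A⊆B)

    module _ {s} (cover : ∀ x → Cover s x) where

      m : ℕ → Fin N → Subset N
      m i x = nthOr⊤ (proj₁ (cover x)) i

      m-proper : ∀ {i x y} → y ∉ m i x → χ (m i x) ≡ c × x ∈ m i x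
      m-proper {i} {x} y∉ = All.lookup (proj₁ (proj₂ (proj₂ (cover x)))) (∉nthOr⊤⇒∈ (proj₁ (cover x)) i y∉)

      m-avoids : ∀ {x y z} → x ≢ y → x ≢ z → ∃ λ i → i < s × AvoidsBoth y z (m i x)
      m-avoids {x} x≢y x≢z =
        let ms , len , _ , covers = cover x
            i , i< , avoids = Any⇒nthOr⊤ (covers x≢y x≢z)
        in i , ≤-trans i< len , avoids

      -- Avoidance is not symmetric while lists are ordered, so each direction needs its own
      -- relation.
      Forward Backward : ℕ → Rel (Fin N) 0ℓ
      Forward  i x y = y ∉ m i x
      Backward i x y = x ∉ m i y

      -- Some `m i h₁` avoids both `h₀`, before `h₁`, and `h₂`, after it. Homogeneity spreads this
      -- to all pairs: no `m i h` contains another listed point. The points of `hs` index the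
      -- members, with `h₀` as common outer point.
      homogeneous⇒split : ∀ {h₀ h₁ h₂ : Fin N} {hs : List (Fin N)} →
        Unique (h₀ ∷ h₁ ∷ h₂ ∷ hs) → s ≤ length hs →
        (∀ {i} → i < s → Homogeneous (Forward i) (h₀ ∷ h₁ ∷ h₂ ∷ hs)) →
        (∀ {i} → i < s → Homogeneous (Backward i) (h₀ ∷ h₁ ∷ h₂ ∷ hs)) →
        SplitAntichain χ c s
      homogeneous⇒split {h₀} {hs = hs} ((h₀≢h₁ ∷ h₀≢h₂ ∷ h₀≢hs) ∷ (h₁≢h₂ ∷ _) ∷ _) s≤ fwd bwd
        with i , i<s , h₀∉ , h₂∉ ← m-avoids (h₀≢h₁ ∘ sym) h₁≢h₂
        with fwd i<s | bwd i<s
      ... | inj₂ (_ ∷ (¬h₂∉ ∷ _) ∷ _) | _ = contradiction h₂∉ ¬h₂∉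
      ... | inj₁ _ | inj₂ ((¬h₀∉ ∷ _) ∷ _) = contradiction h₀∉ ¬h₀∉
      ... | inj₁ (_ ∷ _ ∷ _ ∷ f) | inj₁ ((_ ∷ _ ∷ h₀∉m) ∷ _ ∷ _ ∷ b) = record
        { member      = m i ∘ h
        -- Missing `h₀` shows that the set is not the padding `⊤`.
        ; coloured    = λ j → proj₁ (m-proper (h₀∉h j))
        ; antichain   = λ {j} {k} p → decidable-stable (j Fin.≟ k) λ j≢k →
                          proj₁ (AllPairs-lookup (λ (u , v) → v , u) (AllPairs.zip (b , f))
                            (j≢k ∘ Fin.inject≤-injective s≤ s≤ j k))
                            (p (proj₂ (m-proper (h₀∉h j))))
        ; inner       = h
        ; outer       = λ _ → h₀
        ; inner∈      = λ j → proj₂ (m-proper (h₀∉h j))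
        ; outer∉      = h₀∉h
        ; outer≢inner = λ _ j → All.lookup h₀≢hs (∈-lookup (inject≤ j s≤)) }
        where
        h : Fin s → Fin N
        h j = lookup hs (inject≤ j s≤)
        h₀∉h : ∀ j → h₀ ∉ m i (h j)
        h₀∉h j = All.lookup h₀∉m (∈-lookup (inject≤ j s≤))

      covers⇒split : iteratedRamsey s (iteratedRamsey s (3 + s)) ≤ N → SplitAntichain χ c s
      covers⇒split large
        -- Two rounds of `s` relations each leave `3 + s` points: `h₀`, `h₁`, `h₂` and one for each
        -- member.
        with ys , ys⊑ , ys≥ , fwd ← homogenise Forward (λ i x y → ¬? (y ∈? m i x)) s _ (allFin N)
               (≤-trans large (≤-reflexive (sym (length-tabulate id))))
        with h₀ ∷ h₁ ∷ h₂ ∷ hs , hs⊑ , s≤s (s≤s (s≤s s≤)) , bwd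
               ← homogenise Backward (λ i x y → ¬? (x ∈? m i y)) s _ ys ys≥ =
        homogeneous⇒split (AllPairs-resp-⊑ (Sublist.⊆-trans hs⊑ ys⊑) (allFin⁺ N)) s≤
          (λ i<s → homogeneous-resp hs⊑ (fwd i<s)) bwd

  tripleHits⇒split : ∀ s → iteratedRamsey s (iteratedRamsey s (3 + s)) ≤ N → SplitAntichain χ c s
  tripleHits⇒split s large with collect (λ x → splitOrCover x s [] refl [] [])
  ... | inj₁ split  = split
  ... | inj₂ covers = covers⇒split covers large

cubeOrSplit-n+3 : ∀ {n N} s → iteratedRamsey s (iteratedRamsey s (3 + s)) ≤ N → n + 3 ≤ N →
                  (χ : Subset N → Color) → ∀ c →
                  HasMonoCubeCopy n (opposite c) N χ ⊎ SplitAntichain χ c s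
cubeOrSplit-n+3 s large n+3≤N χ c =
  Sum.map₂ (λ hit → tripleHits⇒split hit s large)
    (collect λ x → collect λ y → collect λ z → tripleHit x y z)
  where
  tripleHit : ∀ x y z → _ ⊎ (x ≢ y → x ≢ z → ∃ λ R → χ R ≡ c × x ∈ R × AvoidsBoth y z R)
  tripleHit x y z with x Fin.≟ y | x Fin.≟ z
  ... | yes x≡y | _ = inj₂ λ x≢y → contradiction x≡y x≢y
  ... | no _ | yes x≡z = inj₂ λ _ x≢z → contradiction x≡z x≢z
  ... | no x≢y | no x≢z with cubeOrHit χ (opposite c) x (y ∷ z ∷ []) (x≢y ∷ x≢z ∷ []) n+3≤N
  ... | inj₁ cube = inj₁ cube
  ... | inj₂ (R , χR , x∈R , y∉R ∷ z∉R ∷ []) =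
        inj₂ λ _ _ → R , trans χR (opposite-involutive c) , x∈R , y∉R , z∉R

-- Ranks within a colour and the Ramsey numbers

module _ {k} (c : Fin k → Color) where

  private
    earlier? : ∀ i → Dec (∃ λ j → j Fin.< i × c j ≡ c i)
    earlier? i = any? λ j → (j Fin.<? i) ×-dec (c j ≟ᶜ c i)

  -- Rank zero marks the first vertex of its colour. Two later vertices of one colour would complete
  -- a monochromatic triple.
  rankInColor : Fin k → Fin 2
  rankInColor i = if does (earlier? i) then suc zero else zero

  module _ (¬three : ¬ HasThreeSameColor c) where

    private
      <⇒rank≢ : ∀ {i j} → i Fin.< j → c i ≡ c j → rankInColor i ≢ rankInColor j
      <⇒rank≢ {i} {j} i<j ci≡cj rank≡ with earlier? i | earlier? j
      ... | yes (l , l<i , cl≡ci) | _ = ¬three (l , i , j ,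
              Fin.<⇒≢ l<i , Fin.<⇒≢ (Fin.<-trans l<i i<j) , Fin.<⇒≢ i<j , cl≡ci , trans cl≡ci ci≡cj)
      ... | no _ | no ¬earlier = ¬earlier (i , i<j , ci≡cj)
      ... | no _ | yes _       = contradiction rank≡ λ ()

    rankInColor-injective : ∀ {i j} → c i ≡ c j → rankInColor i ≡ rankInColor j → i ≡ j
    rankInColor-injective {i} {j} c≡ rank≡ with Fin.<-cmp i j
    ... | tri< i<j _ _ = contradiction rank≡ (<⇒rank≢ i<j c≡)
    ... | tri≈ _ i≡j _ = i≡j
    ... | tri> _ _ j<i = contradiction (sym rank≡) (<⇒rank≢ j<i (sym c≡))

theorem3 : (k : ℕ) → (c : Fin k → Color) → 2 ≤ k → NotMonochromatic c →
    ∃ λ n₀ → ∀ n → n₀ ≤ n →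
    (¬ HasThreeSameColor c → RamseyIs k c n (n + 2)) ×
    (HasThreeSameColor c → RamseyIs k c n (n + 3))
-- `16` is the space required by `bicolour` for `s = 2`; `a` is that for `s = k`, and `b` is the
-- Ramsey bound for `s = k`.
theorem3 k c _ mixed = 16 + (a + b) , λ n n₀≤n →
  let 16≤n = ≤-trans (m≤m+n 16 (a + b)) n₀≤n
      3≤n  = ≤-trans (m≤m+n 3 13) 16≤n
      a≤n  = ≤-trans (≤-trans (m≤m+n a b) (m≤n+m (a + b) 16)) n₀≤n
      b≤n  = ≤-trans (≤-trans (m≤n+m b a) (m≤n+m (a + b) 16)) n₀≤n
  in
  (λ ¬three →
    upperBound c (rankInColor c) (rankInColor-injective c ¬three) (≤-trans 16≤n (m≤m+n n 2))
      (cubeOrSplit-n+2 (≤-trans 3≤n (m≤m+n n 2)) ≤-refl) ,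
    λ N N< → ¬arrows-n+1 mixed 3≤n (≤-trans N< (≤-reflexive (+-comm n 2)))) ,
  (λ three →
    upperBound c id (λ _ i≡j → i≡j) (≤-trans a≤n (m≤m+n n 3))
      (cubeOrSplit-n+3 k (≤-trans b≤n (m≤m+n n 3)) ≤-refl) ,
    λ N N< → ¬arrows-n+2 three 3≤n (≤-trans N< (≤-reflexive (+-comm n 3))))
  where
  a = 2 * (k + k) + 2 * (k + k)
  b = iteratedRamsey k (iteratedRamsey k (3 + k))
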